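{- Let $n,p$ be positive integers with $n>1$, and let $Q=2p$. Then \[ A_{p,p}(Q^n-1)=\begin{cases} Q^n, & \text{if } n \text{ is odd},\\ Q^n+Q, & \text{if } n \text{ is even and } p>1,\\ Q^n+Q+2, & \text{if } n \text{ is even and } p=1. \end{cases} \]
   Context: For positive integers $p,q$, let $\theta_{p,q}$ be the generalised Thue--Morse substitution on $\{0,1\}$, $\theta_{p,q}\colon 0\mapsto 0^p1^q,\ 1\mapsto 1^p0^q$ (extended to words by concatenation), and let $v=v_0v_1v_2\dots=\lim_{n\to\infty}\theta_{p,q}^n(0)\in\{0,1\}^{\mathbb{N}}$ be the generalised Thue--Morse word, indexed from $0$. For positive integers $d,L$, a monochromatic arithmetic progression of difference $d$ and length $L$ in $v$ means that there is $i\ge 0$ with $v_i=v_{i+d}=\dots=v_{i+(L-1)d}$. $A_{p,q}(d)$ denotes the maximum length $L$ of a monochromatic arithmetic progression of difference $d$ in $v$ (this maximum exists and is finite for every $d\geq 1$); $A_{p,p}$ is the case $q=p$. -}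

module Defs where

open import Data.Fin using (Fin; fromℕ<)
open import Data.Fin.Patterns using (0F; 1F)
open import Data.List using (List; []; _∷_; [_]; _++_; concatMap; length; lookup; replicate)
open import Data.List.Properties using (length-++; length-replicate; concatMap-++; ++-assoc; ++-identityʳ)
open import Data.Nat using (ℕ; zero; suc; _+_; _*_; _≤_; _<_; s≤s; z≤n; NonZero)
open import Data.Nat.Properties
  using (+-mono-≤; m≤m+n; ≤-total; m≤n⇒∃[o]m+o≡n; +-suc; +-comm; module ≤-Reasoning)
open import Data.Nat.Tactic.RingSolver using (solve-∀)
open import Data.Product using (_×_; _,_; ∃-syntax)
open import Data.Sum using (inj₁; inj₂)
open import Relation.Binary.PropositionalEquality using (_≡_; refl; sym; trans; cong; cong₂)

Letter : Set
Letter = Fin 2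

Word : Set
Word = List Letter

θ : ℕ → ℕ → Letter → Word
θ p q 0F = replicate p 0F ++ replicate q 1F
θ p q 1F = replicate p 1F ++ replicate q 0F

θ* : ℕ → ℕ → Word → Word
θ* p q = concatMap (θ p q)

-- θ^ p q n is the word θ_{p,q}ⁿ(0).
θ^ : ℕ → ℕ → ℕ → Word
θ^ p q zero    = [ 0F ]
θ^ p q (suc n) = θ* p q (θ^ p q n)

module _ (p q : ℕ) where

  length-θ : ∀ a → length (θ p q a) ≡ p + q
  length-θ 0F = trans (length-++ (replicate p 0F)) (cong₂ _+_ (length-replicate p) (length-replicate q))
  length-θ 1F = trans (length-++ (replicate p 1F)) (cong₂ _+_ (length-replicate p) (length-replicate q))

  length-θ* : ∀ w → length (θ* p q w) ≡ length w * (p + q)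
  length-θ* []      = refl
  length-θ* (a ∷ w) = trans (length-++ (θ p q a)) (cong₂ _+_ (length-θ a) (length-θ* w))

n<length-θ^ : ∀ p q .{{_ : NonZero p}} .{{_ : NonZero q}} n → n < length (θ^ p q n)
n<length-θ^ p q zero = s≤s z≤n
n<length-θ^ p@(suc p′) q@(suc q′) (suc n) = begin
  2 + n                  ≤⟨ s≤s (s≤s (m≤m+n n n)) ⟩
  2 + (n + n)            ≡⟨ cong suc (+-suc n n) ⟨
  suc n + suc n          ≤⟨ +-mono-≤ IH IH ⟩
  m + m                  ≤⟨ m≤m+n (m + m) (m * (p′ + q′)) ⟩
  m + m + m * (p′ + q′)  ≡⟨ ring m p′ q′ ⟩
  m * (p + q)            ≡⟨ length-θ* p q (θ^ p q n) ⟨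
  length (θ^ p q (suc n)) ∎
  where
  open ≤-Reasoning
  m = length (θ^ p q n)
  IH = n<length-θ^ p q n
  ring : ∀ m p′ q′ → m + m + m * (p′ + q′) ≡ m * (suc p′ + suc q′)
  ring = solve-∀

-- The letter v_i of the generalised Thue–Morse word, read off from θⁱ(0), which
-- is long enough; v-limit below shows that every θⁿ(0) is a prefix of v.
v : (p q : ℕ) .{{_ : NonZero p}} .{{_ : NonZero q}} → ℕ → Letter
v p q i = lookup (θ^ p q i) (fromℕ< (n<length-θ^ p q i))

θ^-suc-prefix : ∀ p q .{{_ : NonZero p}} n → ∃[ r ] θ^ p q (suc n) ≡ θ^ p q n ++ r
θ^-suc-prefix (suc p) q zero = _ , refl
θ^-suc-prefix p q (suc n) with r , eq ← θ^-suc-prefix p q n =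
  θ* p q r , trans (cong (θ* p q) eq) (concatMap-++ (θ p q) (θ^ p q n) r)

θ^-prefix : ∀ p q .{{_ : NonZero p}} n k → ∃[ r ] θ^ p q (k + n) ≡ θ^ p q n ++ r
θ^-prefix p q n zero = [] , sym (++-identityʳ _)
θ^-prefix p q n (suc k) with r , eq ← θ^-prefix p q n k | s , eq′ ← θ^-suc-prefix p q (k + n) =
  r ++ s , trans eq′ (trans (cong (_++ s) eq) (++-assoc (θ^ p q n) r s))

lookup-prefix : ∀ {A : Set} (xs ys : List A) {zs} → zs ≡ xs ++ ys → ∀ i .(h : i < length xs) .(h′ : i < length zs) →
                lookup xs (fromℕ< h) ≡ lookup zs (fromℕ< h′)
lookup-prefix (x ∷ xs) ys refl zero    h h′ = refl
lookup-prefix (x ∷ xs) ys refl (suc i) h h′ = lookup-prefix xs ys refl i _ _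

v-limit : ∀ p q .{{_ : NonZero p}} .{{_ : NonZero q}} n i (i<len : i < length (θ^ p q n)) →
          lookup (θ^ p q n) (fromℕ< i<len) ≡ v p q i
v-limit p q n i i<len with ≤-total n i
... | inj₁ n≤i with k , refl ← m≤n⇒∃[o]m+o≡n n≤i
               with r , eq ← θ^-prefix p q n k =
  lookup-prefix (θ^ p q n) r (trans (cong (θ^ p q) (+-comm n k)) eq) i i<len (n<length-θ^ p q i)
... | inj₂ i≤n with k , refl ← m≤n⇒∃[o]m+o≡n i≤n
               with r , eq ← θ^-prefix p q i k =
  sym (lookup-prefix (θ^ p q i) r (trans (cong (θ^ p q) (+-comm i k)) eq) i (n<length-θ^ p q i) i<len)

HasMonochromaticAP : (ℕ → Letter) → (d L : ℕ) → Set
HasMonochromaticAP w d L = ∃[ i ] (∀ j → j < L → w (i + j * d) ≡ w i)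

IsMaximum : (ℕ → Set) → ℕ → Set
IsMaximum P m = P m × (∀ n → P n → n ≤ m)

-- IsA p q d L says that the maximal length A_{p,q}(d) is L.  It is a
-- relation because computing A_{p,q}(d) would need a proof that the lengths are
-- bounded.
IsA : (p q : ℕ) .{{_ : NonZero p}} .{{_ : NonZero q}} → (d L : ℕ) → Set
IsA p q d L = IsMaximum (λ l → 0 < l × HasMonochromaticAP (v p q) d l) L

{-# OPTIONS --safe #-}

-- Let T = Qⁿ and d = T - 1, and read letters mod 2. For y < T we have v (x T + y) = v x + v y, and
-- v (T - 1 - y) = v y + n. Adding d to x T + y gives (x + 1) T + (y - 1) when y > 0, and x T + d when
-- y = 0. If n is odd, v x and v (x T + d) differ from each other, so no monochromatic progression steps
-- past a multiple of T. If n is even, H + 1 terms on each side of the step from e T to e T + d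
-- force v (e - k) + v k = v (e + k) + v k = const for k ≤ H; this is impossible with H = p > 1 (v would
-- have a run of length 2 p - 1) and with H = 2, p = 1 (v would have a factor aabaa). So a progression
-- has at most T + 2 H terms, and near m T² for a suitable m this bound is attained.
module Submission where

open import Defs
open import Data.Empty using (⊥; ⊥-elim)
open import Data.Fin using (fromℕ<; opposite)
open import Data.Fin.Patterns using (0F; 1F)
open import Data.List using (List; []; _∷_; _++_; length; lookup; replicate)
open import Data.List.Properties using (++-assoc; concatMap-++; length-++; length-replicate)
open import Data.Nat using (ℕ; zero; suc; _+_; _*_; _∸_; _^_; _<_; _≤_; _%_; _/_; z≤n; s≤s; z<s; s<s⁻¹; s≤s⁻¹; NonZero; parity)
open import Data.Nat.Divisibility using (_∣_; _∤_; divides)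
open import Data.Nat.DivMod using (m≡m%n+[m/n]*n; m%n<n)
open import Data.Nat.Properties
open import Data.Nat.Tactic.RingSolver using (solve-∀)
open import Data.Parity using (Parity; 0ℙ; 1ℙ; _⁻¹) renaming (_+_ to infixl 6 _⊕_)
import Data.Parity.Properties as ℙ
open import Data.Product using (_×_; _,_; ∃-syntax; proj₁; proj₂)
open import Data.Sum using (_⊎_; inj₁; inj₂)
open import Function using (_∘_)
open import Relation.Nullary using (¬_)
open import Relation.Binary.PropositionalEquality
  using (_≡_; _≢_; refl; sym; trans; cong; cong₂; subst; module ≡-Reasoning)

-- Letters as parities, and positions in words

bit : Letter → Parity
bit 0F = 0ℙ
bit 1F = 1ℙ

bit-injective : ∀ {a b} → bit a ≡ bit b → a ≡ b
bit-injective {0F} {0F} _ = refl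
bit-injective {0F} {1F} ()
bit-injective {1F} {0F} ()
bit-injective {1F} {1F} _ = refl

bit-opposite : ∀ a → bit (opposite a) ≡ bit a ⁻¹
bit-opposite 0F = refl
bit-opposite 1F = refl

lookup-middle : ∀ {A : Set} (us : List A) {a ws zs} → zs ≡ us ++ a ∷ ws →
                .(h : length us < length zs) → lookup zs (fromℕ< h) ≡ a
lookup-middle []       refl h = refl
lookup-middle (u ∷ us) refl h = lookup-middle us refl (s<s⁻¹ h)

split-at : ∀ {A : Set} (zs : List A) i → i < length zs →
           ∃[ us ] ∃[ a ] ∃[ ws ] (zs ≡ us ++ a ∷ ws × length us ≡ i)
split-at (z ∷ zs) zero    _ = [] , z , zs , refl , refl
split-at (z ∷ zs) (suc i) h with us , a , ws , eq , len ← split-at zs i (s<s⁻¹ h) =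
  z ∷ us , a , ws , cong (z ∷_) eq , cong suc len

replicate-split : ∀ {A : Set} r t (a : A) → replicate (suc r + t) a ≡ replicate r a ++ a ∷ replicate t a
replicate-split zero    t a = refl
replicate-split (suc r) t a = cong (a ∷_) (replicate-split r t a)

-- The recursion for `v` under the substitution

module _ (p q : ℕ) .{{_ : NonZero p}} .{{_ : NonZero q}} where

  v-at : ∀ n us {a ws} → θ^ p q n ≡ us ++ a ∷ ws → v p q (length us) ≡ a
  v-at n us {a} {ws} eq = trans (sym (v-limit p q n (length us) us<)) (lookup-middle us eq us<)
    where
    us< : length us < length (θ^ p q n)
    us< = subst (length us <_) (sym (trans (cong length eq) (length-++ us))) (m<m+n (length us) z<s)

  θ-replicate : ∀ a → θ p q a ≡ replicate p a ++ replicate q (opposite a)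
  θ-replicate 0F = refl
  θ-replicate 1F = refl

  -- Cutting `θ^ p q i` at its letter `v p q i` leaves `i` letters in front, and their images fill
  -- exactly `i * (p + q)` positions. The image of the letter itself therefore starts there in the
  -- next power.
  v-image : ∀ i us {a ws} → θ p q (v p q i) ≡ us ++ a ∷ ws → v p q (length us + i * (p + q)) ≡ a
  v-image i us {a} {ws} eq
    with us₀ , b , ws₀ , eq₀ , refl ← split-at (θ^ p q i) i (n<length-θ^ p q i) =
    trans (cong (v p q) (sym len)) (v-at (suc i) (θ* p q us₀ ++ us) factor)
    where
    open ≡-Reasoning
    len : length (θ* p q us₀ ++ us) ≡ length us + length us₀ * (p + q)
    len = trans (length-++ (θ* p q us₀)) (trans (+-comm _ (length us)) (cong (length us +_) (length-θ* p q us₀)))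
    factor : θ^ p q (suc i) ≡ (θ* p q us₀ ++ us) ++ a ∷ (ws ++ θ* p q ws₀)
    factor = begin
      θ* p q (θ^ p q i)                              ≡⟨ cong (θ* p q) eq₀ ⟩
      θ* p q (us₀ ++ b ∷ ws₀)                        ≡⟨ concatMap-++ (θ p q) us₀ (b ∷ ws₀) ⟩
      θ* p q us₀ ++ θ p q b ++ θ* p q ws₀            ≡⟨ cong (λ c → θ* p q us₀ ++ θ p q c ++ θ* p q ws₀) (v-at i us₀ eq₀) ⟨
      θ* p q us₀ ++ θ p q (v p q i) ++ θ* p q ws₀    ≡⟨ cong (λ w → θ* p q us₀ ++ w ++ θ* p q ws₀) eq ⟩
      θ* p q us₀ ++ (us ++ a ∷ ws) ++ θ* p q ws₀     ≡⟨ cong (θ* p q us₀ ++_) (++-assoc us (a ∷ ws) (θ* p q ws₀)) ⟩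
      θ* p q us₀ ++ us ++ a ∷ (ws ++ θ* p q ws₀)     ≡⟨ ++-assoc (θ* p q us₀) us _ ⟨
      (θ* p q us₀ ++ us) ++ a ∷ (ws ++ θ* p q ws₀)   ∎

  v-low : ∀ {r} m → r < p → v p q (r + m * (p + q)) ≡ v p q m
  v-low {r} m r<p with t , eq ← m≤n⇒∃[o]m+o≡n r<p =
    subst (λ l → v p q (l + m * (p + q)) ≡ a) (length-replicate r) (v-image m (replicate r a) factor)
    where
    open ≡-Reasoning
    a = v p q m
    factor : θ p q a ≡ replicate r a ++ a ∷ (replicate t a ++ replicate q (opposite a))
    factor = begin
      θ p q a                                                     ≡⟨ θ-replicate a ⟩
      replicate p a ++ replicate q (opposite a)                   ≡⟨ cong (λ l → replicate l a ++ replicate q (opposite a)) eq ⟨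
      replicate (suc r + t) a ++ replicate q (opposite a)         ≡⟨ cong (_++ replicate q (opposite a)) (replicate-split r t a) ⟩
      (replicate r a ++ a ∷ replicate t a) ++ replicate q (opposite a) ≡⟨ ++-assoc (replicate r a) _ _ ⟩
      replicate r a ++ a ∷ (replicate t a ++ replicate q (opposite a)) ∎

  v-high : ∀ {r} m → r < q → v p q (p + r + m * (p + q)) ≡ opposite (v p q m)
  v-high {r} m r<q with t , eq ← m≤n⇒∃[o]m+o≡n r<q =
    subst (λ l → v p q (l + m * (p + q)) ≡ b) len (v-image m (replicate p a ++ replicate r b) factor)
    where
    open ≡-Reasoning
    a = v p q m
    b = opposite a
    len : length (replicate p a ++ replicate r b) ≡ p + r
    len = trans (length-++ (replicate p a)) (cong₂ _+_ (length-replicate p) (length-replicate r))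
    factor : θ p q a ≡ (replicate p a ++ replicate r b) ++ b ∷ replicate t b
    factor = begin
      θ p q a                                            ≡⟨ θ-replicate a ⟩
      replicate p a ++ replicate q b                     ≡⟨ cong (λ l → replicate p a ++ replicate l b) eq ⟨
      replicate p a ++ replicate (suc r + t) b           ≡⟨ cong (replicate p a ++_) (replicate-split r t b) ⟩
      replicate p a ++ replicate r b ++ b ∷ replicate t b ≡⟨ ++-assoc (replicate p a) _ _ ⟨
      (replicate p a ++ replicate r b) ++ b ∷ replicate t b ∎

-- Parity arithmetic, and sequences additive over base `2 * p` digits

a⊕b⊕b≡a : ∀ a b → a ⊕ b ⊕ b ≡ a
a⊕b⊕b≡a 0ℙ 0ℙ = refl
a⊕b⊕b≡a 0ℙ 1ℙ = refl
a⊕b⊕b≡a 1ℙ 0ℙ = refl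
a⊕b⊕b≡a 1ℙ 1ℙ = refl

a⊕b≡c⇒b≡a⊕c : ∀ a {b c} → a ⊕ b ≡ c → b ≡ a ⊕ c
a⊕b≡c⇒b≡a⊕c 0ℙ      refl = refl
a⊕b≡c⇒b≡a⊕c 1ℙ {0ℙ} refl = refl
a⊕b≡c⇒b≡a⊕c 1ℙ {1ℙ} refl = refl

⊕-shift : ∀ a b c {d} → b ⊕ c ≡ d → a ⊕ b ⊕ c ≡ a ⊕ d
⊕-shift a b c eq = trans (ℙ.+-assoc a b c) (cong (a ⊕_) eq)

-- The hypotheses make `s x` the parity of the number of base `2 * p` digits of `x` that are at
-- least `p`. For `p = 1` this is the Thue-Morse sequence.
module DigitSequence (p : ℕ) .{{_ : NonZero p}} (s : ℕ → Parity) (s-zero : s 0 ≡ 0ℙ)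
         (s-low : ∀ {r} m → r < p → s (r + m * (2 * p)) ≡ s m)
         (s-high : ∀ {r} m → r < p → s (p + r + m * (2 * p)) ≡ s m ⁻¹)
         where

  private
    Q = 2 * p
    instance
      Q≢0 : NonZero Q
      Q≢0 = m*n≢0 2 p

  half : ∀ {r} → r < Q → (r < p) ⊎ (∃[ t ] (r ≡ p + t × t < p))
  half {r} r<Q with <-≤-connex r p
  ... | inj₁ r<p = inj₁ r<p
  ... | inj₂ p≤r with t , refl ← m≤n⇒∃[o]m+o≡n p≤r =
    inj₂ (t , refl , subst (t <_) (+-identityʳ p) (+-cancelˡ-< p t (p + 0) r<Q))

  digits : ∀ y → ∃[ r ] ∃[ x ] (r < Q × y ≡ r + x * Q)
  digits y = y % Q , y / Q , m%n<n y Q , m≡m%n+[m/n]*n y Q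

  s-<p : ∀ {r} → r < p → s r ≡ 0ℙ
  s-<p {r} r<p = trans (cong s (sym (+-identityʳ r))) (trans (s-low 0 r<p) s-zero)

  s-p+ : ∀ {r} → r < p → s (p + r) ≡ 1ℙ
  s-p+ {r} r<p = trans (cong s (sym (+-identityʳ (p + r)))) (trans (s-high 0 r<p) (cong _⁻¹ s-zero))

  s-digit : ∀ m {r} → r < Q → s (r + m * Q) ≡ s m ⊕ s r
  s-digit m {r} r<Q with half r<Q
  ... | inj₁ r<p rewrite s-<p r<p = trans (s-low m r<p) (sym (ℙ.+-identityʳ (s m)))
  ... | inj₂ (t , refl , t<p) rewrite s-p+ t<p = trans (s-high m t<p) (ℙ.+-comm 1ℙ (s m))

  -- Since `y < Q ^ n`, adding `m * Q ^ n` puts the digits of `m` in front of those of `y` without a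
  -- carry, and `s` adds up over digits. The induction peels off the lowest digit.
  s-block : ∀ n m {y} → y < Q ^ n → s (y + m * Q ^ n) ≡ s m ⊕ s y
  s-block zero m {zero} _ = trans (cong s (*-identityʳ m)) (trans (sym (ℙ.+-identityʳ (s m))) (cong (s m ⊕_) (sym s-zero)))
  s-block zero m {suc _} (s≤s ())
  s-block (suc n) m {y} y< with digits y
  ... | r , x , r<Q , refl = begin
    s (r + x * Q + m * (Q * Q ^ n))  ≡⟨ cong s (ring r x m Q (Q ^ n)) ⟩
    s (r + (x + m * Q ^ n) * Q)      ≡⟨ s-digit (x + m * Q ^ n) r<Q ⟩
    s (x + m * Q ^ n) ⊕ s r          ≡⟨ cong (_⊕ s r) (s-block n m x<) ⟩
    s m ⊕ s x ⊕ s r                  ≡⟨ ⊕-shift (s m) (s x) (s r) (sym (s-digit x r<Q)) ⟩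
    s m ⊕ s (r + x * Q)              ∎
    where
    open ≡-Reasoning
    ring : ∀ r x m Q P → r + x * Q + m * (Q * P) ≡ r + (x + m * P) * Q
    ring = solve-∀
    x< : x < Q ^ n
    x< = *-cancelʳ-< Q x (Q ^ n) (≤-<-trans (m≤n+m (x * Q) r) (subst (r + x * Q <_) (*-comm Q (Q ^ n)) y<))

  -- The complement of a digit exchanges the digits below `p` with those from `p` on, so exactly one
  -- of the two has value `1ℙ`.
  s-digit-complement : ∀ {r r′} → suc (r + r′) ≡ Q → s r ⊕ s r′ ≡ 1ℙ
  s-digit-complement {r} {r′} eq with half (≤-trans (s≤s (m≤m+n r r′)) (≤-reflexive eq))
  ... | inj₁ r<p with t , eq′ ← m≤n⇒∃[o]m+o≡n r<p = cong₂ _⊕_ (s-<p r<p) (trans (cong s r′≡) (s-p+ t<p))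
    where
    t<p : t < p
    t<p = ≤-trans (s≤s (m≤n+m t r)) (≤-reflexive eq′)
    ring : ∀ a t p → a + t + (p + 0) ≡ a + (p + t)
    ring = solve-∀
    r′≡ : r′ ≡ p + t
    r′≡ = +-cancelˡ-≡ (suc r) r′ (p + t) (trans eq (trans (cong (_+ (p + 0)) (sym eq′)) (ring (suc r) t p)))
  ... | inj₂ (t , refl , t<p) = cong₂ _⊕_ (s-p+ t<p) (s-<p r′<p)
    where
    ring : ∀ p t r′ → p + suc (t + r′) ≡ suc (p + t + r′)
    ring = solve-∀
    r′<p : r′ < p
    r′<p = ≤-trans (s≤s (m≤n+m r′ t))
             (≤-reflexive (trans (+-cancelˡ-≡ p (suc (t + r′)) (p + 0) (trans (ring p t r′) eq)) (+-identityʳ p)))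

  -- Complementing to `Q ^ n - 1` complements each of the `n` digits separately, and every pair of
  -- digits contributes `1ℙ`.
  s-complement : ∀ n {y z} → suc (y + z) ≡ Q ^ n → s y ⊕ s z ≡ parity n
  s-complement zero {zero} {zero} eq = cong₂ _⊕_ s-zero s-zero
  s-complement (suc n) {y} {z} eq with digits y
  ... | r , x , r<Q , refl
    with r′ , eqr ← m≤n⇒∃[o]m+o≡n r<Q
       | x′ , eqx ← m≤n⇒∃[o]m+o≡n (*-cancelʳ-< Q x (Q ^ n) (≤-trans (s≤s (≤-trans (m≤n+m (x * Q) r) (m≤m+n _ z)))
                      (≤-reflexive (trans eq (*-comm Q (Q ^ n))))))
    = begin
    s (r + x * Q) ⊕ s z                  ≡⟨ cong (λ w → s (r + x * Q) ⊕ s w) z≡ ⟩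
    s (r + x * Q) ⊕ s (r′ + x′ * Q)      ≡⟨ cong₂ _⊕_ (s-digit x r<Q) (s-digit x′ r′<Q) ⟩
    s x ⊕ s r ⊕ (s x′ ⊕ s r′)            ≡⟨ interchange (s x) (s r) (s x′) (s r′) ⟩
    s x ⊕ s x′ ⊕ (s r ⊕ s r′)            ≡⟨ cong₂ _⊕_ (s-complement n eqx) (s-digit-complement eqr) ⟩
    parity n ⊕ 1ℙ                        ≡⟨ ℙ.+-comm (parity n) 1ℙ ⟩
    parity n ⁻¹                          ≡⟨ cong _⁻¹ (ℙ.suc-homo-⁻¹ n) ⟨
    parity (suc n) ⁻¹ ⁻¹                 ≡⟨ ℙ.⁻¹-involutive (parity (suc n)) ⟩
    parity (suc n)                       ∎
    where
    open ≡-Reasoning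
    open import Algebra.Properties.CommutativeSemigroup ℙ.+-commutativeSemigroup using (interchange)
    ring : ∀ r r′ x x′ Q → suc (r + x * Q) + (r′ + x′ * Q) ≡ suc r + r′ + (x + x′) * Q
    ring = solve-∀
    z≡ : z ≡ r′ + x′ * Q
    z≡ = +-cancelˡ-≡ (suc (r + x * Q)) z (r′ + x′ * Q) (trans eq (sym
           (trans (ring r r′ x x′ Q) (trans (cong (_+ (x + x′) * Q) eqr)
             (trans (cong (_* Q) eqx) (*-comm (Q ^ n) Q))))))
    r′<Q : r′ < Q
    r′<Q = ≤-trans (s≤s (m≤n+m r′ r)) (≤-reflexive eqr)

  -- Here f + H is the index e at which two stretches of H + 1 terms of the progression meet.
  Blocked : ℕ → ℕ → Set
  Blocked n H = ∀ f C → (∀ k y → k + y ≡ H → s (f + k) ⊕ s y ≡ C) →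
                (∀ k → k ≤ H → s (f + H + k) ⊕ s k ≡ C ⊕ parity n) → ⊥

  -- Upper bound for progressions of difference `d = T - 1`

  module _ (n d : ℕ) (Qⁿ≡1+d : Q ^ n ≡ suc d) where

    s-window : ∀ x {y} → y ≤ d → s (y + x * suc d) ≡ s x ⊕ s y
    s-window x {y} y≤d = subst (λ T → y < T → s (y + x * T) ≡ s x ⊕ s y) Qⁿ≡1+d (s-block n x) (s≤s y≤d)

    s-mirror : ∀ {y z} → y + z ≡ d → s y ⊕ s z ≡ parity n
    s-mirror eq = s-complement n (trans (cong suc eq) (sym Qⁿ≡1+d))

    -- A step of `d` lowers the residue modulo `suc d` by one, cyclically, so `suc d` consecutive
    -- terms meet every residue.
    hits-residue : ∀ H → H ≤ d → ∀ i → ∃[ j ] ∃[ f ] (j ≤ d × i + j * d ≡ H + f * suc d)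
    hits-residue H H≤d i with b ← i % suc d | a ← i / suc d | s≤s b≤d ← m%n<n i (suc d) | eq ← m≡m%n+[m/n]*n i (suc d)
      with <-≤-connex b H
    ... | inj₂ H≤b with j , refl ← m≤n⇒∃[o]m+o≡n H≤b =
      j , a + j , ≤-trans (m≤n+m j H) b≤d , trans (cong (_+ j * d) eq) (ring H j a d)
      where
      ring : ∀ H j a d → H + j + a * suc d + j * d ≡ H + (a + j) * suc d
      ring = solve-∀
    -- From residue `b`, `b + 1` steps wrap around to `d`, and `w = d - H` more reach `H`. Each step
    -- raises the quotient by one except the wrapping step from `0` to `d`, hence the quotient
    -- `a + w + b`.
    ... | inj₁ b<H with w , eqw ← m≤n⇒∃[o]m+o≡n H≤d =
      suc (w + b) , a + w + b ,
      subst (suc (w + b) ≤_) eqw (subst (_≤ H + w) (cong suc (+-comm b w)) (+-monoˡ-≤ w b<H)) ,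
      trans (cong (λ u → u + (d + (w + b) * d)) eq)
        (trans (cong (λ u → b + a * suc d + (u + (w + b) * d)) (sym eqw)) (ring b a d w H))
      where
      ring : ∀ b a d w H → b + a * suc d + (H + w + (w + b) * d) ≡ H + (a + w + b) * suc d
      ring = solve-∀

    -- By `hits-residue` some early term has residue `H`. From it, `H + 1` terms run down to residue
    -- `0` and the next `H + 1` run down from `d`; mirroring the residues of the latter gives the
    -- pattern that `Blocked` excludes.
    length-bound : ∀ H → H ≤ d → Blocked n H → ∀ L i →
                   (∀ j → j < L → s (i + j * d) ≡ s i) → L ≤ suc d + 2 * H
    length-bound H H≤d blocked L i ap = ≮⇒≥ contra
      where
      contra : ¬ (suc d + 2 * H < L)
      contra long with j , f , j≤d , eq ← hits-residue H H≤d i = blocked f (s i) left right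
        where
        open ≡-Reasoning
        shift : ∀ k → i + (j + k) * d ≡ H + f * suc d + k * d
        shift k = trans (ring i j k d) (cong (_+ k * d) eq)
          where
          ring : ∀ i j k d → i + (j + k) * d ≡ i + j * d + k * d
          ring = solve-∀
        -- As `j ≤ d` and `L` is at least `d + 2 * H + 2`, all terms from `j` to `j + 2 * H + 1`
        -- belong to the progression.
        value : ∀ k → k ≤ suc (2 * H) → s (H + f * suc d + k * d) ≡ s i
        value k k≤ = trans (cong s (sym (shift k))) (ap (j + k)
          (≤-trans (s≤s (≤-trans (+-mono-≤ j≤d k≤) (≤-reflexive (+-suc d (2 * H))))) long))
        left : ∀ k y → k + y ≡ H → s (f + k) ⊕ s y ≡ s i
        left k y refl = begin
          s (f + k) ⊕ s y                     ≡⟨ s-window (f + k) (≤-trans (m≤n+m y k) H≤d) ⟨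
          s (y + (f + k) * suc d)             ≡⟨ cong s (ring f k y d) ⟩
          s (k + y + f * suc d + k * d)       ≡⟨ value k (m≤n⇒m≤1+n (≤-trans (m≤m+n k y) (m≤m+n (k + y) _))) ⟩
          s i                                 ∎
          where
          ring : ∀ f k y d → y + (f + k) * suc d ≡ k + y + f * suc d + k * d
          ring = solve-∀
        right : ∀ k → k ≤ H → s (f + H + k) ⊕ s k ≡ s i ⊕ parity n
        right k k≤H with z , eqz ← m≤n⇒∃[o]m+o≡n (≤-trans k≤H H≤d) = begin
          s (f + H + k) ⊕ s k                    ≡⟨ cong (s (f + H + k) ⊕_) sk ⟩
          s (f + H + k) ⊕ (s z ⊕ parity n)       ≡⟨ ℙ.+-assoc (s (f + H + k)) (s z) (parity n) ⟨
          s (f + H + k) ⊕ s z ⊕ parity n         ≡⟨ cong (_⊕ parity n) (s-window (f + H + k) (subst (z ≤_) eqz (m≤n+m z k))) ⟨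
          s (z + (f + H + k) * suc d) ⊕ parity n ≡⟨ cong (λ u → s u ⊕ parity n) pos ⟩
          s (H + f * suc d + suc (H + k) * d) ⊕ parity n
            ≡⟨ cong (_⊕ parity n) (value (suc (H + k)) (s≤s (+-monoʳ-≤ H (≤-trans k≤H (m≤m+n H 0))))) ⟩
          s i ⊕ parity n                         ∎
          where
          sk : s k ≡ s z ⊕ parity n
          sk = a⊕b≡c⇒b≡a⊕c (s z) (trans (ℙ.+-comm (s z) (s k)) (s-mirror eqz))
          ring : ∀ z f H k d → z + (f + H + k) * suc d ≡ H + f * suc d + (k + z + (H + k) * d)
          ring = solve-∀
          pos : z + (f + H + k) * suc d ≡ H + f * suc d + suc (H + k) * d
          pos = trans (ring z f H k d) (cong (λ u → H + f * suc d + (u + (H + k) * d)) eqz)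

    -- Progressions that attain the bound

    s-diagonal : ∀ m k y → k + y ≡ d → s (y + (k + m * suc d) * suc d) ≡ s m ⊕ parity n
    s-diagonal m k y eq = begin
      s (y + (k + m * suc d) * suc d)  ≡⟨ s-window (k + m * suc d) (subst (y ≤_) eq (m≤n+m y k)) ⟩
      s (k + m * suc d) ⊕ s y          ≡⟨ cong (_⊕ s y) (s-window m (subst (k ≤_) eq (m≤m+n k y))) ⟩
      s m ⊕ s k ⊕ s y                  ≡⟨ ⊕-shift (s m) (s k) (s y) (s-mirror eq) ⟩
      s m ⊕ parity n                   ∎
      where open ≡-Reasoning

    -- In base `T = suc d` the index `d + j * d` has the two digits `j` and `d - j`. They are
    -- complementary, so the value does not depend on `j`.
    short-progression : ∀ j → j < suc d → s (d + j * d) ≡ parity n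
    short-progression j (s≤s j≤d) with y , eq ← m≤n⇒∃[o]m+o≡n j≤d = begin
      s (d + j * d)                    ≡⟨ cong (λ u → s (u + j * d)) eq ⟨
      s (j + y + j * d)                ≡⟨ cong s (ring j y d) ⟩
      s (y + (j + 0 * suc d) * suc d)  ≡⟨ s-diagonal 0 j y eq ⟩
      s 0 ⊕ parity n                   ≡⟨ cong (_⊕ parity n) s-zero ⟩
      parity n                         ∎
      where
      open ≡-Reasoning
      ring : ∀ j y d → j + y + j * d ≡ y + (j + 0 * suc d) * suc d
      ring = solve-∀

    -- The progression has three stretches: `h + 1` terms ending at index `(1 + m) * T * T`, then
    -- the `T` terms of a diagonal, then `h + 1` more. In the outer stretches the mirror turns a
    -- value into a sum of `s` at two neighbouring small numbers and at `m` or `2 + m`, which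
    -- `before` and `after` equate with `s (1 + m)`. The term next to the diagonal on each side has
    -- this value without a condition, hence `k < h`.
    module _ (n-even : parity n ≡ 0ℙ) (m h : ℕ) (h≤d : h ≤ d)
             (before : ∀ k → k < h → s m ⊕ s k ⊕ s (suc k) ≡ s (1 + m))
             (after : ∀ k → k < h → s (2 + m) ⊕ s k ⊕ s (suc k) ≡ s (1 + m)) where

      private
        T = suc d
        g = suc (d ∸ h)

        h+g≡T : h + g ≡ T
        h+g≡T = trans (+-suc h (d ∸ h)) (cong suc (m+[n∸m]≡n h≤d))

        s-mirror-even : ∀ {y z} → y + z ≡ d → s y ≡ s z
        s-mirror-even {y} {z} eq = trans (a⊕b≡c⇒b≡a⊕c (s z) (trans (ℙ.+-comm (s z) (s y)) (trans (s-mirror eq) n-even)))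
                                     (ℙ.+-identityʳ (s z))

        s-multiple : ∀ x → s (x * T) ≡ s x
        s-multiple x = trans (s-window x z≤n) (trans (cong (s x ⊕_) s-zero) (ℙ.+-identityʳ (s x)))

        -- After `h` steps the residue `h` has dropped to `0` and the quotient `g + m * T` has grown
        -- to `T + m * T`, so the index is `(1 + m) * T * T`.
        start : ℕ
        start = h + (g + m * T) * T

        initial : ∀ j k → j + k ≡ h → s (start + j * d) ≡ s (1 + m)
        initial j k eq = begin
          s (h + (g + m * T) * T + j * d)      ≡⟨ cong (λ u → s (u + (g + m * T) * T + j * d)) eq ⟨
          s (j + k + (g + m * T) * T + j * d)  ≡⟨ cong s (ring j k (g + m * T) d) ⟩
          s (k + (j + (g + m * T)) * T)        ≡⟨ s-window (j + (g + m * T)) (≤-trans (subst (k ≤_) eq (m≤n+m k j)) h≤d) ⟩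
          s (j + (g + m * T)) ⊕ s k            ≡⟨ cong (λ u → s u ⊕ s k) (+-assoc j g (m * T)) ⟨
          s (j + g + m * T) ⊕ s k              ≡⟨ tail k eq ⟩
          s (1 + m)                            ∎
          where
          open ≡-Reasoning
          ring : ∀ j k x d → j + k + x * suc d + j * d ≡ k + (j + x) * suc d
          ring = solve-∀
          tail : ∀ k → j + k ≡ h → s (j + g + m * T) ⊕ s k ≡ s (1 + m)
          tail zero eq = begin
            s (j + g + m * T) ⊕ s 0  ≡⟨ cong (s (j + g + m * T) ⊕_) s-zero ⟩
            s (j + g + m * T) ⊕ 0ℙ   ≡⟨ ℙ.+-identityʳ _ ⟩
            s (j + g + m * T)        ≡⟨ cong (λ u → s (u + m * T)) (trans (cong (_+ g) (trans (sym (+-identityʳ j)) eq)) h+g≡T) ⟩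
            s ((1 + m) * T)          ≡⟨ s-multiple (1 + m) ⟩
            s (1 + m)                ∎
          -- Here `j + g = d - k`, so the mirror replaces `s (j + g)` by `s k`, as in `before`.
          tail (suc k) eq = begin
            s (j + g + m * T) ⊕ s (suc k)   ≡⟨ cong (_⊕ s (suc k)) (s-window m (subst (j + g ≤_) j+g+k≡d (m≤m+n (j + g) k))) ⟩
            s m ⊕ s (j + g) ⊕ s (suc k)     ≡⟨ cong (λ u → s m ⊕ u ⊕ s (suc k)) (s-mirror-even j+g+k≡d) ⟩
            s m ⊕ s k ⊕ s (suc k)           ≡⟨ before k (subst (suc k ≤_) eq (m≤n+m (suc k) j)) ⟩
            s (1 + m)                       ∎
            where
            ring′ : ∀ j g k → suc (j + g + k) ≡ j + suc k + g
            ring′ = solve-∀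
            j+g+k≡d : j + g + k ≡ d
            j+g+k≡d = suc-injective (trans (ring′ j g k) (trans (cong (_+ g) eq) h+g≡T))

        start-later : ∀ k → start + (suc h + k) * d ≡ (1 + m) * T * T + (d + k * d)
        start-later k = trans (ring h g m d k) (cong (λ u → (u + m * T) * T + (d + k * d)) h+g≡T)
          where
          ring : ∀ h g m d k → h + (g + m * suc d) * suc d + (suc h + k) * d ≡ (h + g + m * suc d) * suc d + (d + k * d)
          ring = solve-∀

        middle : ∀ k y → k + y ≡ d → s (start + (suc h + k) * d) ≡ s (1 + m)
        middle k y eq = begin
          s (start + (suc h + k) * d)              ≡⟨ cong s (start-later k) ⟩
          s ((1 + m) * T * T + (d + k * d))        ≡⟨ cong (λ u → s ((1 + m) * T * T + (u + k * d))) eq ⟨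
          s ((1 + m) * T * T + (k + y + k * d))    ≡⟨ cong s (ring ((1 + m) * T) k y d) ⟩
          s (y + (k + (1 + m) * T) * T)            ≡⟨ s-diagonal (1 + m) k y eq ⟩
          s (1 + m) ⊕ parity n                     ≡⟨ cong (s (1 + m) ⊕_) n-even ⟩
          s (1 + m) ⊕ 0ℙ                           ≡⟨ ℙ.+-identityʳ _ ⟩
          s (1 + m)                                ∎
          where
          open ≡-Reasoning
          ring : ∀ x k y d → x * suc d + (k + y + k * d) ≡ y + (k + x) * suc d
          ring = solve-∀

        final : ∀ k y → k ≤ h → k + y ≡ d → s (start + (suc h + (T + k)) * d) ≡ s (1 + m)
        final k y k≤h eq = begin
          s (start + (suc h + (T + k)) * d)              ≡⟨ cong s (start-later (T + k)) ⟩
          s ((1 + m) * T * T + (d + (T + k) * d))        ≡⟨ cong (λ u → s ((1 + m) * T * T + (u + (T + k) * d))) eq ⟨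
          s ((1 + m) * T * T + (k + y + (T + k) * d))    ≡⟨ cong s (ring ((1 + m) * T) k y d) ⟩
          s (y + (k + (d + (1 + m) * T)) * T)            ≡⟨ s-window _ (subst (y ≤_) eq (m≤n+m y k)) ⟩
          s (k + (d + (1 + m) * T)) ⊕ s y                ≡⟨ cong (s (k + (d + (1 + m) * T)) ⊕_) (s-mirror-even (trans (+-comm y k) eq)) ⟩
          s (k + (d + (1 + m) * T)) ⊕ s k                ≡⟨ tail k k≤h ⟩
          s (1 + m)                                      ∎
          where
          open ≡-Reasoning
          ring : ∀ x k y d → x * suc d + (k + y + (suc d + k) * d) ≡ y + (k + (d + x)) * suc d
          ring = solve-∀
          tail : ∀ k → k ≤ h → s (k + (d + (1 + m) * T)) ⊕ s k ≡ s (1 + m)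
          tail zero _ = begin
            s (d + (1 + m) * T) ⊕ s 0    ≡⟨ cong (s (d + (1 + m) * T) ⊕_) (s-mirror-even (+-identityʳ d)) ⟨
            s (d + (1 + m) * T) ⊕ s d    ≡⟨ cong (_⊕ s d) (s-window (1 + m) ≤-refl) ⟩
            s (1 + m) ⊕ s d ⊕ s d        ≡⟨ a⊕b⊕b≡a (s (1 + m)) (s d) ⟩
            s (1 + m)                    ∎
          -- The sum `suc k + d` equals `k + T`, which carries into block `2 + m`.
          tail (suc k) k<h = begin
            s (suc k + (d + (1 + m) * T)) ⊕ s (suc k)  ≡⟨ cong (λ u → s u ⊕ s (suc k)) (+-suc k (d + (1 + m) * T)) ⟨
            s (k + (2 + m) * T) ⊕ s (suc k)            ≡⟨ cong (_⊕ s (suc k)) (s-window (2 + m) (≤-trans (<⇒≤ k<h) h≤d)) ⟩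
            s (2 + m) ⊕ s k ⊕ s (suc k)                ≡⟨ after k k<h ⟩
            s (1 + m)                                  ∎

      long-progression : ∃[ i ] (∀ j → j < suc d + 2 * suc h → s (i + j * d) ≡ s (1 + m))
      long-progression = start , value
        where
        ring : ∀ h d l → suc h + (suc d + l) ≡ suc h + suc d + l
        ring = solve-∀
        ring′ : ∀ h d → suc d + 2 * suc h ≡ suc h + suc d + suc h
        ring′ = solve-∀
        l≤h : ∀ l → suc h + (suc d + l) < suc d + 2 * suc h → l ≤ h
        l≤h l lt = s≤s⁻¹ (+-cancelˡ-< (suc h + suc d) l (suc h)
                     (subst (_< suc h + suc d + suc h) (ring h d l) (subst (suc h + (suc d + l) <_) (ring′ h d) lt)))
        value : ∀ j → j < suc d + 2 * suc h → s (start + j * d) ≡ s (1 + m)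
        value j j<L with ≤-<-connex j h
        ... | inj₁ j≤h with k , eq ← m≤n⇒∃[o]m+o≡n j≤h = initial j k eq
        ... | inj₂ h<j with k , refl ← m≤n⇒∃[o]m+o≡n h<j with ≤-<-connex k d
        ...   | inj₁ k≤d with y , eq ← m≤n⇒∃[o]m+o≡n k≤d = middle k y eq
        ...   | inj₂ d<k with l , refl ← m≤n⇒∃[o]m+o≡n d<k
                with y , eq ← m≤n⇒∃[o]m+o≡n (≤-trans (l≤h l j<L) h≤d) = final l y (l≤h l j<L) eq

  -- Exclusion of the blocked patterns, and a choice of `m`

  blocked-odd : ∀ n → parity n ≡ 1ℙ → Blocked n 0
  -- For `H = 0` both hypotheses concern the single index `f`, where they demand `C` and its
  -- opposite.
  blocked-odd n odd f C left right = ℙ.p≢p⁻¹ C (begin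
    C                          ≡⟨ left 0 0 refl ⟨
    s (f + 0) ⊕ s 0            ≡⟨ cong (λ u → s u ⊕ s 0) (+-identityʳ (f + 0)) ⟨
    s (f + 0 + 0) ⊕ s 0        ≡⟨ right 0 z≤n ⟩
    C ⊕ parity n               ≡⟨ cong (C ⊕_) odd ⟩
    C ⊕ 1ℙ                     ≡⟨ ℙ.+-comm C 1ℙ ⟩
    C ⁻¹                       ∎)
    where open ≡-Reasoning

  -- As `s 1` and `s 2` agree, the pattern forces equal values at `f`, `f + 1` and at `f + 3`,
  -- `f + 4`. One of these pairs starts at an even index `2 x`, where `s` takes opposite values at
  -- `2 x` and `2 x + 1`.
  blocked-one : ∀ n → parity n ≡ 0ℙ → p ≡ 1 → Blocked n 2
  blocked-one n even p≡1 f C left right with digits f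
  ... | r , x , r<Q , f≡ = by-residue (subst (λ q → r < 2 * q) p≡1 r<Q)
                                      (subst (λ q → f ≡ r + x * (2 * q)) p≡1 f≡)
    where
    s-even : ∀ x → s (x * 2) ≡ s x
    s-even x = subst (λ q → s (x * (2 * q)) ≡ s x) p≡1 (s-low x (subst (0 <_) (sym p≡1) z<s))
    s-odd : ∀ x → s (1 + x * 2) ≡ s x ⁻¹
    s-odd x = subst (λ q → s (q + 0 + x * (2 * q)) ≡ s x ⁻¹) p≡1 (s-high x (subst (0 <_) (sym p≡1) z<s))
    s-1≡s-2 : s 1 ≡ s 2
    s-1≡s-2 = sym (s-even 1)
    s-even≢s-odd : ∀ x → s (x * 2) ≢ s (1 + x * 2)
    s-even≢s-odd x eq = ℙ.p≢p⁻¹ (s x) (trans (sym (s-even x)) (trans eq (s-odd x)))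
    first-two : s (f + 0) ≡ s (f + 1)
    first-two = ℙ.+-cancelʳ-≡ (s 2) _ _ (trans (left 0 2 refl)
                  (trans (sym (left 1 1 refl)) (cong (s (f + 1) ⊕_) s-1≡s-2)))
    last-two : s (f + 2 + 1) ≡ s (f + 2 + 2)
    last-two = ℙ.+-cancelʳ-≡ (s 2) _ _ (trans (cong (s (f + 2 + 1) ⊕_) (sym s-1≡s-2))
                 (trans (right 1 (s≤s z≤n)) (sym (right 2 ≤-refl))))
    by-residue : ∀ {r} → r < 2 → f ≡ r + x * 2 → ⊥
    by-residue {0} _ refl = s-even≢s-odd x (trans (cong s (sym (+-identityʳ (x * 2))))
                              (trans first-two (cong s (+-comm (x * 2) 1))))
    by-residue {1} _ refl = s-even≢s-odd (2 + x) (trans (cong s (ring₁ x)) (trans last-two (cong s (ring₂ x))))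
      where
      ring₁ : ∀ x → (2 + x) * 2 ≡ 1 + x * 2 + 2 + 1
      ring₁ = solve-∀
      ring₂ : ∀ x → 1 + x * 2 + 2 + 2 ≡ 1 + (2 + x) * 2
      ring₂ = solve-∀
    by-residue {suc (suc _)} (s≤s (s≤s ())) _

  -- A blocked pattern would be a maximal constant run of length 2 p - 1 in s, but runs have length p or 2 p.
  blocked-many : ∀ n → parity n ≡ 0ℙ → 1 < p → Blocked n p
  blocked-many n even 1<p f C left right with w , 2+w≡p ← m≤n⇒∃[o]m+o≡n 1<p with digits f
  ... | r , x , r<Q , refl = by-half (half r<Q)
    where
    0<p : 0 < p
    0<p = <-trans z<s 1<p
    s-p : s p ≡ 1ℙ
    s-p = trans (cong s (sym (+-identityʳ p))) (s-p+ 0<p)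
    s-p-1 : s (suc w) ≡ 0ℙ
    s-p-1 = s-<p (≤-reflexive 2+w≡p)
    differ : ∀ {a a′ b b′ c} → a ⊕ b ≡ c → a′ ⊕ b′ ≡ c → b ≡ 1ℙ → b′ ≡ 0ℙ → a ≢ a′
    differ {a} ab≡c a′b′≡c refl refl refl with () ← ℙ.+-cancelˡ-≡ a 1ℙ 0ℙ (trans ab≡c (sym a′b′≡c))
    first-two : s (f + 0) ≢ s (f + 1)
    first-two = differ (left 0 p refl) (left 1 (suc w) 2+w≡p) s-p s-p-1
    last-two : s (f + p + p) ≢ s (f + p + suc w)
    last-two = differ (right p ≤-refl) (right (suc w) (subst (suc w ≤_) 2+w≡p (n≤1+n (suc w)))) s-p s-p-1
    next : ∀ y → y + p + suc w + 1 ≡ y + p + p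
    next y = trans (+-assoc (y + p) (suc w) 1) (cong (y + p +_) (trans (+-comm (suc w) 1) 2+w≡p))
    ring₁ : ∀ t x p → suc t + x * (2 * p) + p + p ≡ suc (t + (1 + x) * (2 * p))
    ring₁ = solve-∀
    ring₂ : ∀ t x p → p + suc t + x * (2 * p) + p + p ≡ p + suc t + (1 + x) * (2 * p)
    ring₂ = solve-∀
    last-before : ∀ {y z} → y + p + p ≡ suc z → y + p + suc w ≡ z
    last-before {y} eq = suc-injective (trans (+-comm 1 (y + p + suc w)) (trans (next y) eq))
    -- On each half block of length `p`, `s` is constant. If `p` divides `f`, then `f` and `f + 1`
    -- share a half block, against `first-two`; otherwise `f + 2 p - 1` and `f + 2 p` do, against
    -- `last-two`.
    by-half : (r < p) ⊎ (∃[ t ] (r ≡ p + t × t < p)) → ⊥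
    by-half (inj₁ r<p) = low r<p refl
      where
      low : ∀ {r′} → r′ < p → r ≡ r′ → ⊥
      low {zero} _ refl = first-two (trans (cong s (+-identityʳ (x * Q)))
        (trans (s-low x 0<p) (sym (trans (cong s (+-comm (x * Q) 1)) (s-low x 1<p)))))
      low {suc t} t<p refl = last-two (trans (cong s (ring₁ t x p)) (trans (s-low (1 + x) t<p)
        (sym (trans (cong s (last-before {suc t + x * Q} (ring₁ t x p))) (s-low (1 + x) (<⇒≤ t<p))))))
    by-half (inj₂ (zero , refl , _)) = first-two (trans (cong s (+-identityʳ (p + 0 + x * Q)))
      (trans (s-high x 0<p) (sym (trans (cong s (ring x p)) (s-high x 1<p)))))
      where
      ring : ∀ x p → p + 0 + x * (2 * p) + 1 ≡ p + 1 + x * (2 * p)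
      ring = solve-∀
    by-half (inj₂ (suc t , refl , t<p)) = last-two (trans (cong s (ring₂ t x p)) (trans (s-high (1 + x) t<p)
      (sym (trans (cong s (last-before {p + suc t + x * Q} (trans (ring₂ t x p) (cong (_+ (1 + x) * Q) (+-suc p t)))))
        (s-high (1 + x) (<⇒≤ t<p))))))

  -- The index p Q lies in the middle of a run of length 2 p in s.
  middle-of-run : ∀ h → suc h ≡ p → 1 < p → ∃[ m ]
    ( (∀ k → k < h → s m ⊕ s k ⊕ s (suc k) ≡ s (1 + m))
    × (∀ k → k < h → s (2 + m) ⊕ s k ⊕ s (suc k) ≡ s (1 + m)))
  middle-of-run h 1+h≡p 1<p = m , (λ k k<h → constant k k<h s-m) , (λ k k<h → constant k k<h s-2+m)
    where
    -- This is `p * Q - 1`, the end of the upper half of block `h`. That half and the lower half of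
    -- block `p` both have value `1ℙ`, while `s` vanishes on all indices up to `h`.
    m = p + h + h * Q
    0<p : 0 < p
    0<p = <-trans z<s 1<p
    h<p : h < p
    h<p = ≤-reflexive 1+h≡p
    s-p : s p ≡ 1ℙ
    s-p = trans (cong s (sym (+-identityʳ p))) (s-p+ 0<p)
    s-m : s m ≡ 1ℙ
    s-m = trans (s-high h h<p) (cong _⁻¹ (s-<p h<p))
    ring : ∀ p h x → suc (p + h + x) ≡ p + suc h + x
    ring = solve-∀
    1+m≡ : 1 + m ≡ p * Q
    1+m≡ = begin
      suc (p + h + h * Q)  ≡⟨ ring p h (h * Q) ⟩
      p + suc h + h * Q    ≡⟨ cong (λ u → p + u + h * Q) (trans 1+h≡p (sym (+-identityʳ p))) ⟩
      suc h * Q            ≡⟨ cong (_* Q) 1+h≡p ⟩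
      p * Q                ∎
      where open ≡-Reasoning
    s-1+m : s (1 + m) ≡ 1ℙ
    s-1+m = trans (cong s 1+m≡) (trans (s-low p 0<p) s-p)
    s-2+m : s (2 + m) ≡ 1ℙ
    s-2+m = trans (cong (s ∘ suc) 1+m≡) (trans (s-low p 1<p) s-p)
    constant : ∀ k → k < h → ∀ {a} → a ≡ 1ℙ → a ⊕ s k ⊕ s (suc k) ≡ s (1 + m)
    constant k k<h refl = trans (cong₂ (λ a b → 1ℙ ⊕ a ⊕ b) (s-<p (<-trans k<h h<p))
      (s-<p (subst (suc k <_) 1+h≡p (s≤s k<h)))) (sym s-1+m)

-- Divisibility by two, and application to the word `v`

parity≡0⇒2∣ : ∀ n → parity n ≡ 0ℙ → 2 ∣ n
parity≡0⇒2∣ zero          _  = divides 0 refl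
parity≡0⇒2∣ (suc zero)    ()
parity≡0⇒2∣ (suc (suc n)) eq with divides q refl ← parity≡0⇒2∣ n eq = divides (suc q) refl

2∣⇒parity≡0 : ∀ {n} → 2 ∣ n → parity n ≡ 0ℙ
2∣⇒parity≡0 (divides q refl) = trans (ℙ.*-homo-* q 2) (ℙ.*-zeroʳ (parity q))

2∤⇒parity≡1 : ∀ {n} → 2 ∤ n → parity n ≡ 1ℙ
2∤⇒parity≡1 {n} 2∤n with parity n in eq
... | 0ℙ = ⊥-elim (2∤n (parity≡0⇒2∣ n eq))
... | 1ℙ = refl

-- For `p = 1` the choice is `m = 3`, `h = 1`: the word begins with 011010, so the letter at `4`
-- differs from both neighbours, and the first two letters supply the compensating change.
isolated-4 : ∀ p .{{_ : NonZero p}} → p ≡ 1 → ∀ k → k < 1 →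
             bit (v p p 3) ⊕ bit (v p p k) ⊕ bit (v p p (suc k)) ≡ bit (v p p 4)
           × bit (v p p 5) ⊕ bit (v p p k) ⊕ bit (v p p (suc k)) ≡ bit (v p p 4)
isolated-4 _ refl zero    _ = refl , refl
isolated-4 _ refl (suc _) (s≤s ())

module _ (p : ℕ) .{{_ : NonZero p}} where

  private
    Q = 2 * p

  vᵇ : ℕ → Parity
  vᵇ = bit ∘ v p p

  2*p≡p+p : 2 * p ≡ p + p
  2*p≡p+p = cong (p +_) (+-identityʳ p)

  vᵇ-low : ∀ {r} m → r < p → vᵇ (r + m * Q) ≡ vᵇ m
  vᵇ-low {r} m r<p = trans (cong (λ q → vᵇ (r + m * q)) 2*p≡p+p) (cong bit (v-low p p m r<p))

  vᵇ-high : ∀ {r} m → r < p → vᵇ (p + r + m * Q) ≡ vᵇ m ⁻¹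
  vᵇ-high {r} m r<p = trans (cong (λ q → vᵇ (p + r + m * q)) 2*p≡p+p)
                        (trans (cong bit (v-high p p m r<p)) (bit-opposite (v p p m)))

  private module V = DigitSequence p vᵇ refl vᵇ-low vᵇ-high

  isA : ∀ n d H → Q ^ n ≡ suc d → H ≤ d → V.Blocked n H →
        ∀ C → ∃[ i ] (∀ j → j < suc d + 2 * H → vᵇ (i + j * d) ≡ C) → IsA p p d (suc d + 2 * H)
  isA n d H eq H≤d blocked C (i , constant) =
    (z<s , i , λ j j<L → bit-injective (trans (constant j j<L)
      (sym (trans (cong vᵇ (sym (+-identityʳ i))) (constant 0 z<s)))))
    , λ L (_ , i , ap) → V.length-bound n d eq H H≤d blocked L i (λ j j<L → cong bit (ap j j<L))

  isA-odd : ∀ n d → Q ^ n ≡ suc d → parity n ≡ 1ℙ → IsA p p d (suc d)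
  isA-odd n d eq odd = subst (IsA p p d) (+-identityʳ (suc d))
    (isA n d 0 eq z≤n (V.blocked-odd n odd) (parity n)
      (d , λ j j<L → V.short-progression n d eq j (subst (j <_) (+-identityʳ (suc d)) j<L)))

  isA-even-many : ∀ n d → Q ^ n ≡ suc d → p ≤ d → parity n ≡ 0ℙ → 1 < p → IsA p p d (suc d + 2 * p)
  isA-even-many n d eq p≤d even 1<p
    with h , 1+h≡p ← m≤n⇒∃[o]m+o≡n (<⇒≤ 1<p)
    with m , before , after ← V.middle-of-run h 1+h≡p 1<p =
    isA n d p eq p≤d (V.blocked-many n even 1<p) (vᵇ (1 + m))
      (subst (λ H → ∃[ i ] (∀ j → j < suc d + 2 * H → vᵇ (i + j * d) ≡ vᵇ (1 + m))) 1+h≡p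
        (V.long-progression n d eq even m h (<⇒≤ (subst (_≤ d) (sym 1+h≡p) p≤d)) before after))

  isA-even-one : ∀ n d → Q ^ n ≡ suc d → 2 ≤ d → parity n ≡ 0ℙ → p ≡ 1 → IsA p p d (suc d + 4)
  isA-even-one n d eq 2≤d even p≡1 =
    isA n d 2 eq 2≤d (V.blocked-one n even p≡1) (vᵇ 4)
      (V.long-progression n d eq even 3 1 (<⇒≤ 2≤d)
        (λ k k<1 → proj₁ (isolated-4 p p≡1 k k<1)) (λ k k<1 → proj₂ (isolated-4 p p≡1 k k<1)))

proposition28 : (n p : ℕ) .{{_ : NonZero p}} → 1 < n →
    let Q = 2 * p in
    (2 ∤ n → IsA p p (Q ^ n ∸ 1) (Q ^ n))
    × (2 ∣ n → 1 < p → IsA p p (Q ^ n ∸ 1) (Q ^ n + Q))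
    × (2 ∣ n → p ≡ 1 → IsA p p (Q ^ n ∸ 1) (Q ^ n + Q + 2))
proposition28 n p 1<n = by-predecessor (Q ^ n) refl
  where
  Q = 2 * p
  instance
    Q≢0 : NonZero Q
    Q≢0 = m*n≢0 2 p
  -- Abstracting `Q ^ n` as `T` lets `T ∸ 1` reduce to `d` once `T` is matched with `suc d`.
  by-predecessor : ∀ T → Q ^ n ≡ T →
      (2 ∤ n → IsA p p (T ∸ 1) T)
    × (2 ∣ n → 1 < p → IsA p p (T ∸ 1) (T + Q))
    × (2 ∣ n → p ≡ 1 → IsA p p (T ∸ 1) (T + Q + 2))
  by-predecessor zero    eq = ⊥-elim (<-irrefl (sym eq) (m^n>0 Q n))
  by-predecessor (suc d) eq =
      (λ 2∤n → isA-odd p n d eq (2∤⇒parity≡1 2∤n))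
    , (λ 2∣n 1<p → isA-even-many p n d eq (s≤s⁻¹ p<T) (2∣⇒parity≡0 2∣n) 1<p)
    , (λ 2∣n p≡1 → subst (IsA p p d) (trans (cong (λ p → suc d + (2 * p + 2)) (sym p≡1)) (sym (+-assoc (suc d) Q 2)))
                     (isA-even-one p n d eq (2≤d p≡1) (2∣⇒parity≡0 2∣n) p≡1))
    where
    -- The assumption `1 < n` enters here: it makes `T` large enough for `H ≤ d`, with `H = p`, or
    -- `H = 2` when `p = 1`.
    Q²≤T : Q ^ 2 ≤ suc d
    Q²≤T = subst (Q ^ 2 ≤_) eq (^-monoʳ-≤ Q 1<n)
    p<T : p < suc d
    p<T = begin-strict
      p      ≡⟨ *-identityˡ p ⟨
      1 * p  <⟨ *-monoˡ-< p (n<1+n 1) ⟩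
      Q      ≡⟨ ^-identityʳ Q ⟨
      Q ^ 1  ≤⟨ ^-monoʳ-≤ Q (n≤1+n 1) ⟩
      Q ^ 2  ≤⟨ Q²≤T ⟩
      suc d  ∎
      where open ≤-Reasoning
    2≤d : p ≡ 1 → 2 ≤ d
    2≤d p≡1 = s≤s⁻¹ (≤-trans (n≤1+n 3) (subst (λ p → (2 * p) ^ 2 ≤ suc d) p≡1 Q²≤T))
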